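{- Let $G=(V,A)$ be a finite directed graph with arc costs $c:A\to\mathbb{R}_{\ge 0}$ and terminals $s_1,s_2,t\in V$, and assume that $G$ contains at least one directed $s_1$-$s_2$ path. Let $\mathrm{OPT}$ be the minimum of $c(F)=\sum_{e\in F}c(e)$ over all arc sets $F\subseteq A$ such that, in $G-F$, there is a directed path from $s_1$ to $s_2$ and there is no directed path from $s_1$ to $t$. Let $R=V\setminus\{t\}$ and, for $X\subseteq R$, let $$f(X)=\min\{c(\delta^+(U)) : X\subseteq U\subseteq R\}.$$ Then $$\mathrm{OPT}=\min\{f(V(P)) : P\text{ is a directed } s_1\text{ - }s_2\text{ path in } G-t\}.$$
   Context: For $U\subseteq V$, $\delta^+(U)=\{(u,v)\in A: u\in U,\ v\notin U\}$ is the directed out-cut, and $c(\delta^+(U))$ is the sum of the costs of its arcs. $V(P)$ is the vertex set of the path $P$. $G-F$ is obtained by deleting the arcs in $F$; $G-t$ is obtained by deleting the vertex $t$. The minimum over an empty family is $+\infty$ (this concerns infeasible instances only). -}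

module Defs where

open import Algebra.Bundles using (AbelianGroup)
open import Algebra.Structures using (IsAbelianGroup)
open import Data.Bool.Base using (if_then_else_)
open import Data.Fin.Base using (Fin; zero; suc)
open import Data.Fin.Properties using (_≟_; any?; injective⇒≤)
open import Data.Fin.Subset
  using (Subset; inside; outside; _∈_; _⊆_; ⊤; ∁; ⁅_⁆; ⋃)
open import Data.Fin.Subset.Properties
  using (_∈?_; _⊆?_; ∈⊤; x∉p⇒x∈∁p; x∈⁅y⁆⇒x≡y)
open import Data.List.Base
  using (List; []; _∷_; [_]; _++_; map; concatMap; filter; allFin; length; lookup)
import Data.List.Extrema as Extrema
open import Data.List.Membership.Propositional using () renaming (_∈_ to _∈ˡ_)
open import Data.List.Membership.Propositional.Properties
  using ( ∈-map⁺; ∈-++⁺ˡ; ∈-++⁺ʳ; ∈-concatMap⁺; ∈-allFin; ∈-filter⁺; ∈-filter⁻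
        ; ∈-lookup )
import Data.List.Relation.Unary.All as All
open import Data.List.Relation.Unary.AllPairs using ([]; _∷_)
open import Data.List.Relation.Unary.Any as Any using (here; there)
open import Data.List.Relation.Unary.Unique.Propositional using (Unique)
import Data.List.Relation.Unary.Unique.DecPropositional as UniqueDec
open import Data.Nat.Base using (ℕ; zero; suc; s≤s) renaming (_≤_ to _≤ℕ_)
open import Data.Product.Base using (∃; _×_; _,_; proj₁; proj₂)
open import Data.Product.Properties using (≡-dec)
open import Data.Vec.Base as Vec using ([]; _∷_; tabulate)
open import Data.Vec.Properties using (lookup∘tabulate; []=⇒lookup; lookup⇒[]=)
open import Function.Base using (_∘_)
open import Function.Definitions using (Injective)
open import Level using (Level; _⊔_) renaming (suc to lsuc)
open import Relation.Binary.Bundles using (TotalOrder)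
open import Relation.Binary.Core using (Rel)
open import Relation.Binary.PropositionalEquality.Core
  using (_≡_; _≢_; refl; sym; trans; cong)
open import Relation.Binary.Structures using (IsTotalOrder)
import Relation.Binary.Construct.Add.Supremum.Equality as SupEquality
import Relation.Binary.Construct.Add.Supremum.NonStrict as SupNonStrict
open import Relation.Nullary.Construct.Add.Supremum as Sup using (_⁺; ⊤⁺)
open import Relation.Nullary.Decidable
  using (Dec; yes; no; does; map′; _×-dec_; ¬?; dec-true)
open import Relation.Nullary.Negation using (¬_; contradiction)
open import Relation.Unary using (Pred; Decidable)

private
  variable
    a p : Level
    A : Set a
    n : ℕ

-- The totally ordered abelian groups include the additive group of the reals;
-- nothing else about ℝ is used to speak of sums and minima of costs.

record OrderedAbelianGroup c ℓ₁ ℓ₂ : Set (lsuc (c ⊔ ℓ₁ ⊔ ℓ₂)) where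
  infix  4 _≈_ _≤_
  infixl 6 _+_
  infix  8 -_
  field
    Carrier        : Set c
    _≈_            : Rel Carrier ℓ₁
    _≤_            : Rel Carrier ℓ₂
    _+_            : Carrier → Carrier → Carrier
    0#             : Carrier
    -_             : Carrier → Carrier
    isAbelianGroup : IsAbelianGroup _≈_ _+_ 0# -_
    isTotalOrder   : IsTotalOrder _≈_ _≤_
    +-monoˡ-≤      : ∀ z {x y} → x ≤ y → (x + z) ≤ (y + z)

  abelianGroup : AbelianGroup c ℓ₁
  abelianGroup = record { isAbelianGroup = isAbelianGroup }

  open AbelianGroup abelianGroup public using (commutativeMonoid; monoid; rawMonoid)

  open SupEquality _≈_ public using (_≈⁺_)
  open SupNonStrict _≤_ public using (_≤⁺_)

  totalOrder⁺ : TotalOrder c (c ⊔ ℓ₁) (c ⊔ ℓ₂)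
  totalOrder⁺ = record { isTotalOrder = SupNonStrict.≤⁺-isTotalOrder _≤_ isTotalOrder }

-- Repetitions among the elements are allowed: a minimum over the family depends
-- only on P.

record Listing {A : Set a} (P : Pred A p) : Set (a ⊔ p) where
  field
    elements : List A
    sound    : ∀ {x} → x ∈ˡ elements → P x
    complete : ∀ {x} → P x → x ∈ˡ elements

listFilter : {P : Pred A p} → Decidable P → (xs : List A) →
             (∀ {x} → P x → x ∈ˡ xs) → Listing P
listFilter P? xs complete = record
  { elements = filter P? xs
  ; sound    = λ x∈ → proj₂ (∈-filter⁻ P? {xs = xs} x∈)
  ; complete = λ Px → ∈-filter⁺ P? (complete Px) Px
  }

inhabited? : {P : Pred A p} → Listing P → Dec (∃ P)
inhabited? record { elements = []    ; complete = complete } =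
  no λ (_ , Px) → contradiction (complete Px) λ ()
inhabited? record { elements = x ∷ _ ; sound = sound } = yes (x , sound (here refl))

module _ {P : Pred (Fin n) p} where

  ⟦_⟧ : Decidable P → Subset n
  ⟦ P? ⟧ = tabulate (does ∘ P?)

  ∈⟦⟧⁺ : (P? : Decidable P) → ∀ {i} → P i → i ∈ ⟦ P? ⟧
  ∈⟦⟧⁺ P? {i} Pi = lookup⇒[]= i ⟦ P? ⟧
    (trans (lookup∘tabulate (does ∘ P?) i) (dec-true (P? i) Pi))

  ∈⟦⟧⁻ : (P? : Decidable P) → ∀ {i} → i ∈ ⟦ P? ⟧ → P i
  ∈⟦⟧⁻ P? {i} i∈ with P? i
                    | trans (sym (lookup∘tabulate (does ∘ P?) i)) ([]=⇒lookup i∈)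
  ... | yes Pi | _  = Pi
  ... | no _   | ()

subsets : ∀ n → List (Subset n)
subsets zero    = [ [] ]
subsets (suc n) = map (inside ∷_) (subsets n) ++ map (outside ∷_) (subsets n)

∈-subsets : (U : Subset n) → U ∈ˡ subsets n
∈-subsets []            = here refl
∈-subsets (inside ∷ U)  = ∈-++⁺ˡ (∈-map⁺ _ (∈-subsets U))
∈-subsets {suc n} (outside ∷ U) =
  ∈-++⁺ʳ (map (inside ∷_) (subsets n)) (∈-map⁺ _ (∈-subsets U))

sequences : (n k : ℕ) → List (List (Fin n))
sequences n zero    = [ [] ]
sequences n (suc k) = [] ∷ concatMap (λ v → map (v ∷_) (sequences n k)) (allFin n)

∈-sequences : ∀ k (vs : List (Fin n)) → length vs ≤ℕ k → vs ∈ˡ sequences n k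
∈-sequences zero    []       _        = here refl
∈-sequences (suc k) []       _        = here refl
∈-sequences (suc k) (v ∷ vs) (s≤s le) =
  there (∈-concatMap⁺ (λ w → map (w ∷_) (sequences _ k))
    (Any.map (λ { refl → ∈-map⁺ _ (∈-sequences k vs le) }) (∈-allFin v)))

lookup-injective : {xs : List A} → Unique xs → Injective _≡_ _≡_ (lookup xs)
lookup-injective (_ ∷ _)  {zero}  {zero}  _  = refl
lookup-injective (px ∷ _) {zero}  {suc j} eq =
  contradiction eq (All.lookup px (∈-lookup j))
lookup-injective (px ∷ _) {suc i} {zero}  eq =
  contradiction (sym eq) (All.lookup px (∈-lookup i))
lookup-injective (_ ∷ u)  {suc i} {suc j} eq = cong Fin.suc (lookup-injective u eq)

unique⇒length≤ : {vs : List (Fin n)} → Unique vs → length vs ≤ℕ n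
unique⇒length≤ u = injective⇒≤ (lookup-injective u)

-- The arc set is a finite set of ordered pairs of vertices, indexed by Fin #arcs.

record Digraph : Set where
  field
    #vertices #arcs : ℕ

  Vertex = Fin #vertices
  Arc    = Fin #arcs

  field
    ends           : Arc → Vertex × Vertex
    ends-injective : Injective _≡_ _≡_ ends

  tail head : Arc → Vertex
  tail = proj₁ ∘ ends
  head = proj₂ ∘ ends

  record Subgraph : Set where
    field
      vertices : Subset #vertices
      arcs     : Subset #arcs
      closed   : ∀ {e} → e ∈ arcs → tail e ∈ vertices × head e ∈ vertices

  open Subgraph

  whole : Subgraph
  whole = record { vertices = ⊤ ; arcs = ⊤ ; closed = λ _ → ∈⊤ , ∈⊤ }

  deleteArcs : Subset #arcs → Subgraph
  deleteArcs F = record { vertices = ⊤ ; arcs = ∁ F ; closed = λ _ → ∈⊤ , ∈⊤ }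

  avoids? : ∀ t → Decidable (λ e → tail e ≢ t × head e ≢ t)
  avoids? t e = ¬? (tail e ≟ t) ×-dec ¬? (head e ≟ t)

  deleteVertex : Vertex → Subgraph
  deleteVertex t = record
    { vertices = ∁ ⁅ t ⁆
    ; arcs     = ⟦ avoids? t ⟧
    ; closed   = λ e∈ → let (tail≢t , head≢t) = ∈⟦⟧⁻ (avoids? t) e∈ in
        x∉p⇒x∈∁p (tail≢t ∘ x∈⁅y⁆⇒x≡y t) , x∉p⇒x∈∁p (head≢t ∘ x∈⁅y⁆⇒x≡y t)
    }

  -- Walk H u v P : the list P is the vertex sequence of a directed walk in H
  -- from u to v.  A single vertex of H is a walk from itself to itself.

  data Walk (H : Subgraph) : Vertex → Vertex → List Vertex → Set where
    stop : ∀ {v} → v ∈ vertices H → Walk H v v [ v ]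
    step : ∀ {u w v P} e → e ∈ arcs H → ends e ≡ (u , w) →
           Walk H w v P → Walk H u v (u ∷ P)

  IsPath : Subgraph → Vertex → Vertex → Pred (List Vertex) _
  IsPath H u v P = Walk H u v P × Unique P

  HasPath : Subgraph → Vertex → Vertex → Set
  HasPath H u v = ∃ (IsPath H u v)

  V⟨_⟩ : List Vertex → Subset #vertices
  V⟨ P ⟩ = ⋃ (map ⁅_⁆ P)

  walk? : ∀ H u v → Decidable (Walk H u v)
  walk? H u v [] = no λ ()
  walk? H u v (x ∷ []) = map′
    (λ { (refl , refl , v∈) → stop v∈ })
    (λ { (stop v∈) → refl , refl , v∈ ; (step _ _ _ ()) })
    (u ≟ x ×-dec v ≟ x ×-dec u ∈? vertices H)
  walk? H u v (x ∷ y ∷ P) = map′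
    (λ { (refl , (e , e∈ , eq) , W) → step e e∈ eq W })
    uncons
    (u ≟ x ×-dec any? (λ e → e ∈? arcs H ×-dec ≡-dec _≟_ _≟_ (ends e) (x , y))
           ×-dec walk? H y v (y ∷ P))
    where
    source : ∀ {w z Q} → Walk H w v (z ∷ Q) → w ≡ z
    source (stop _)       = refl
    source (step _ _ _ _) = refl

    uncons : Walk H u v (x ∷ y ∷ P) →
             u ≡ x × (∃ λ e → e ∈ arcs H × ends e ≡ (x , y)) × Walk H y v (y ∷ P)
    uncons (step e e∈ eq W) with source W
    ... | refl = refl , (e , e∈ , eq) , W

  paths : ∀ H u v → Listing (IsPath H u v)
  paths H u v = listFilter
    (λ P → walk? H u v P ×-dec UniqueDec.unique? _≟_ P)
    (sequences #vertices #vertices)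
    (λ {P} (_ , unique) → ∈-sequences _ P (unique⇒length≤ unique))

  hasPath? : ∀ H u v → Dec (HasPath H u v)
  hasPath? H u v = inhabited? (paths H u v)

  Feasible : Vertex → Vertex → Vertex → Pred (Subset #arcs) _
  Feasible s₁ s₂ t F =
    HasPath (deleteArcs F) s₁ s₂ × ¬ HasPath (deleteArcs F) s₁ t

  feasibleSets : ∀ s₁ s₂ t → Listing (Feasible s₁ s₂ t)
  feasibleSets s₁ s₂ t = listFilter
    (λ F → hasPath? (deleteArcs F) s₁ s₂ ×-dec ¬? (hasPath? (deleteArcs F) s₁ t))
    (subsets #arcs) (λ _ → ∈-subsets _)

  δ⁺ : Subset #vertices → Subset #arcs
  δ⁺ U = ⟦ (λ e → tail e ∈? U ×-dec ¬? (head e ∈? U)) ⟧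

  between : ∀ X R → Listing (λ (U : Subset #vertices) → X ⊆ U × U ⊆ R)
  between X R = listFilter (λ U → X ⊆? U ×-dec U ⊆? R)
    (subsets #vertices) (λ _ → ∈-subsets _)

module MinCost {c ℓ₁ ℓ₂} (K : OrderedAbelianGroup c ℓ₁ ℓ₂) (G : Digraph) where

  open OrderedAbelianGroup K
  open Digraph G
  open import Algebra.Properties.CommutativeMonoid.Sum commutativeMonoid using (sum)

  -- The minimum of g over P in Carrier ∪ {+∞}; it is +∞ = ⊤⁺ when P is empty.

  minimum : {A : Set a} {P : Pred A p} → (A → Carrier ⁺) → Listing P → Carrier ⁺
  minimum g L = Extrema.min totalOrder⁺ ⊤⁺ (map g (Listing.elements L))

  cost : (Arc → Carrier) → Subset #arcs → Carrier
  cost c F = sum λ e → if Vec.lookup F e then c e else 0#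

  OPT : (Arc → Carrier) → Vertex → Vertex → Vertex → Carrier ⁺
  OPT c s₁ s₂ t = minimum (λ F → Sup.[ cost c F ]) (feasibleSets s₁ s₂ t)

  f : (Arc → Carrier) → Vertex → Subset #vertices → Carrier ⁺
  f c t X = minimum (λ U → Sup.[ cost c (δ⁺ U) ]) (between X (∁ ⁅ t ⁆))

{-# OPTIONS --safe #-}

-- If F is feasible, the set U of vertices reachable from s₁ in G − F avoids t,
-- contains every s₁-s₂ path of G − F, and δ⁺(U) ⊆ F because an arc of G − F
-- leaving U would make its head reachable; so f(V(P)) ≤ c(δ⁺(U)) ≤ c(F).
-- Conversely, if V(P) ⊆ U ⊆ R, then δ⁺(U) is feasible: it contains no arc of P,
-- and no walk of G − δ⁺(U) starting at s₁ leaves U.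

module Submission where

open import Defs
open import Algebra.Bundles using (CommutativeMonoid)
open import Data.Bool.Base using (if_then_else_; true; false)
open import Data.Fin.Base using (Fin; zero; suc)
open import Data.Fin.Properties using (_≟_)
open import Data.Fin.Subset using (Subset; _∈_; _⊆_; ∁; ⁅_⁆)
open import Data.Fin.Subset.Properties
  using ( _∈?_; ∈⊤; ∉⊥; x∈⁅x⁆; x∈⁅y⁆⇒x≡y; x∉⁅y⁆⇒x≢y; x≢y⇒x∉⁅y⁆; x∈p∪q⁺; x∈p∪q⁻
        ; x∈∁p⇒x∉p; x∉p⇒x∈∁p; x∉∁p⇒x∈p )
open import Data.List.Base using (List; []; _∷_)
import Data.List.Extrema as Extrema
open import Data.List.Membership.Propositional using (lose) renaming (_∈_ to _∈ˡ_)
import Data.List.Membership.DecPropositional as DecMembership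
open import Data.List.Membership.Propositional.Properties using (∈-map⁺)
import Data.List.Relation.Unary.All as All
import Data.List.Relation.Unary.All.Properties as All
open import Data.List.Relation.Unary.AllPairs using ([]; _∷_)
open import Data.List.Relation.Unary.Any using (here; there)
open import Data.Nat.Base using (zero; suc)
open import Data.Product.Base using (∃; _×_; _,_; proj₁; proj₂)
open import Data.Sum.Base using (inj₁; inj₂)
import Data.Vec.Base as Vec
open import Data.Vec.Properties using ([]=⇒lookup; lookup⇒[]=)
open import Function.Base using (_∘_)
open import Relation.Binary.Bundles using (TotalOrder)
import Relation.Binary.Construct.Add.Supremum.NonStrict as SupNonStrict
open import Relation.Binary.PropositionalEquality.Core
  using (_≢_; refl; sym; trans; cong; subst)
open import Relation.Binary.Structures using (IsTotalOrder)
open import Relation.Nullary.Construct.Add.Supremum using (_⁺; ⊤⁺)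
open import Relation.Nullary.Decidable using (yes; no; ¬?; _×-dec_)
open import Relation.Nullary.Negation using (¬_; contradiction)
open import Relation.Unary using (Pred; Decidable)

module Walks (G : Digraph) where

  open Digraph G
  open Subgraph

  private
    variable
      H H′ : Subgraph
      u v w x : Vertex
      P Q : List Vertex

  ∈V⁺ : x ∈ˡ P → x ∈ V⟨ P ⟩
  ∈V⁺ (here refl) = x∈p∪q⁺ (inj₁ (x∈⁅x⁆ _))
  ∈V⁺ (there x∈P) = x∈p∪q⁺ (inj₂ (∈V⁺ x∈P))

  ∈V⁻ : x ∈ V⟨ P ⟩ → x ∈ˡ P
  ∈V⁻ {P = []}    x∈ = contradiction x∈ ∉⊥
  ∈V⁻ {P = y ∷ P} x∈ with x∈p∪q⁻ ⁅ y ⁆ V⟨ P ⟩ x∈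
  ... | inj₁ x∈y = here (x∈⁅y⁆⇒x≡y y x∈y)
  ... | inj₂ x∈P = there (∈V⁻ x∈P)

  source∈ : Walk H u v P → u ∈ˡ P
  source∈ (stop _)       = here refl
  source∈ (step _ _ _ _) = here refl

  -- The initial segment up to `x`. Its vertex sequence is forgotten, since it only serves to show
  -- that vertices on a path are reachable from its source.
  takeTo : Walk H u v P → x ∈ˡ P → ∃ (Walk H u x)
  takeTo (stop v∈)          (here refl) = _ , stop v∈
  takeTo {H = H} (step e e∈ eq W) (here refl) =
    -- A one-vertex walk needs its vertex in `H`; closedness of `H` supplies this for the tail of
    -- `e`.
    _ , stop (subst (_∈ vertices H) (cong proj₁ eq) (proj₁ (closed H e∈)))
  takeTo (step e e∈ eq W) (there x∈) =
    _ , step e e∈ eq (proj₂ (takeTo W x∈))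

  _++ʷ_ : Walk H u v P → Walk H v w Q → ∃ (Walk H u w)
  stop _         ++ʷ W′ = _ , W′
  step e e∈ eq W ++ʷ W′ = _ , step e e∈ eq (proj₂ (W ++ʷ W′))

  dropTo : IsPath H u v P → x ∈ˡ P → HasPath H x v
  dropTo (W@(stop _)       , un)     (here refl) = _ , W , un
  dropTo (W@(step _ _ _ _) , un)     (here refl) = _ , W , un
  dropTo (step _ _ _ W     , _ ∷ un) (there x∈)  = dropTo (W , un) x∈

  -- Loop erasure: the rest of the walk is first made a path; if `u` occurs on it, the final segment
  -- starting at `u` is the result, otherwise `u` is put in front.
  walk⇒path : Walk H u v P → HasPath H u v
  walk⇒path (stop v∈) = _ , stop v∈ , All.[] ∷ []
  walk⇒path {u = u} (step e e∈ eq W) with walk⇒path W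
  ... | Q , W′ , un with DecMembership._∈?_ _≟_ u Q
  ...   | yes u∈Q = dropTo (W′ , un) u∈Q
  ...   | no  u∉Q = _ , step e e∈ eq W′ , All.¬Any⇒All¬ Q u∉Q ∷ un

  -- The vertex sequence stays `P`, so `Unique P` and `V⟨ P ⟩` carry over. Restricting to arcs with
  -- both ends on `P` lets the caller use what is known about the vertices of `P`.
  walk-transfer : (∀ {x} → x ∈ˡ P → x ∈ vertices H′) →
                  (∀ {e} → e ∈ arcs H → tail e ∈ˡ P → head e ∈ˡ P → e ∈ arcs H′) →
                  Walk H u v P → Walk H′ u v P
  walk-transfer vs as (stop _)         = stop (vs (here refl))
  walk-transfer vs as (step e e∈ eq W) =
    step e
      (as e∈ (here (cong proj₁ eq))
             (there (subst (_∈ˡ _) (sym (cong proj₂ eq)) (source∈ W))))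
      eq
      (walk-transfer (vs ∘ there) (λ e∈ t∈ h∈ → as e∈ (there t∈) (there h∈)) W)

  walk-stays : {U : Subset #vertices} →
               (∀ {e} → e ∈ arcs H → tail e ∈ U → head e ∈ U) →
               Walk H u v P → u ∈ U → v ∈ U
  walk-stays         U-closed (stop _)         u∈ = u∈
  walk-stays {U = U} U-closed (step e e∈ eq W) u∈ =
    walk-stays U-closed W
      (subst (_∈ U) (cong proj₂ eq)
        (U-closed e∈ (subst (_∈ U) (sym (cong proj₁ eq)) u∈)))

  reachable : Subgraph → Vertex → Subset #vertices
  reachable H u = ⟦ hasPath? H u ⟧

  ∈reachable⁺ : Walk H u v P → v ∈ reachable H u
  ∈reachable⁺ {H = H} {u = u} W = ∈⟦⟧⁺ (hasPath? H u) (walk⇒path W)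

  ∈reachable⁻ : v ∈ reachable H u → HasPath H u v
  ∈reachable⁻ {H = H} {u = u} = ∈⟦⟧⁻ (hasPath? H u)

  reachable-closed : ∀ {e} → e ∈ arcs H →
                     tail e ∈ reachable H u → head e ∈ reachable H u
  reachable-closed {H = H} {e = e} e∈ tail∈ =
    let (_ , W , _) = ∈reachable⁻ tail∈
    in ∈reachable⁺ (proj₂ (W ++ʷ step e e∈ refl (stop (proj₂ (closed H e∈)))))

  -- The decision procedure inside `δ⁺`, named so that `δ⁺ U` is definitionally `⟦ leaves? U ⟧` and
  -- `∈⟦⟧⁺`, `∈⟦⟧⁻` apply to cuts.
  leaves? : ∀ U → Decidable (λ e → tail e ∈ U × ¬ (head e ∈ U))
  leaves? U e = tail e ∈? U ×-dec ¬? (head e ∈? U)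

  δ⁺-reachable⊆ : ∀ F → δ⁺ (reachable (deleteArcs F) u) ⊆ F
  δ⁺-reachable⊆ {u = u} F e∈δ =
    let (tail∈ , head∉) = ∈⟦⟧⁻ (leaves? (reachable (deleteArcs F) u)) e∈δ
    in x∉∁p⇒x∈p λ e∈∁F → head∉ (reachable-closed e∈∁F tail∈)

  δ⁺-feasible : ∀ {s₁ s₂ t U} → IsPath (deleteVertex t) s₁ s₂ P →
                V⟨ P ⟩ ⊆ U → U ⊆ ∁ ⁅ t ⁆ → Feasible s₁ s₂ t (δ⁺ U)
  δ⁺-feasible {t = t} {U = U} (W , un) P⊆U U⊆R =
      (_ , walk-transfer (λ _ → ∈⊤) inside-kept W , un)
    -- A walk from `s₁` to `t` would keep `t` inside `U`, against `U ⊆ ∁ ⁅ t ⁆`; it starts in `U`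
    -- because `s₁` is the first vertex of `P`.
    , λ (_ , W′ , _) →
        x∈∁p⇒x∉p (U⊆R (walk-stays kept-stays W′ (P⊆U (∈V⁺ (source∈ W))))) (x∈⁅x⁆ t)
    where
    inside-kept : ∀ {e} → e ∈ arcs (deleteVertex t) →
                  tail e ∈ˡ _ → head e ∈ˡ _ → e ∈ ∁ (δ⁺ U)
    inside-kept _ _ h∈ = x∉p⇒x∈∁p λ e∈δ →
      proj₂ (∈⟦⟧⁻ (leaves? U) e∈δ) (P⊆U (∈V⁺ h∈))

    kept-stays : ∀ {e} → e ∈ ∁ (δ⁺ U) → tail e ∈ U → head e ∈ U
    kept-stays {e} e∈ tail∈ with head e ∈? U
    ... | yes head∈ = head∈
    ... | no  head∉ =
      contradiction (∈⟦⟧⁺ (leaves? U) (tail∈ , head∉)) (x∈∁p⇒x∉p e∈)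

  -- The path that survives in G - F already lies in G - t: all its vertices are reachable from
  -- `s₁`, and `t` is not.
  feasible-path : ∀ {s₁ s₂ t F} → Feasible s₁ s₂ t F →
                  let U = reachable (deleteArcs F) s₁ in
                  ∃ λ P → IsPath (deleteVertex t) s₁ s₂ P × V⟨ P ⟩ ⊆ U × U ⊆ ∁ ⁅ t ⁆
  feasible-path {s₁ = s₁} {t = t} {F = F} ((P , W , un) , ¬s₁t) =
    P , (walk-transfer (U⊆R ∘ P⊆U) avoid W , un) , P⊆U ∘ ∈V⁻ , U⊆R
    where
    U = reachable (deleteArcs F) s₁

    U⊆R : U ⊆ ∁ ⁅ t ⁆
    U⊆R x∈U = x∉p⇒x∈∁p (x≢y⇒x∉⁅y⁆ λ { refl → ¬s₁t (∈reachable⁻ x∈U) })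

    P⊆U : x ∈ˡ P → x ∈ U
    P⊆U x∈ = ∈reachable⁺ (proj₂ (takeTo W x∈))

    ≢t : x ∈ˡ P → x ≢ t
    ≢t x∈ = x∉⁅y⁆⇒x≢y (x∈∁p⇒x∉p (U⊆R (P⊆U x∈)))

    avoid : ∀ {e} → e ∈ ∁ F → tail e ∈ˡ P → head e ∈ˡ P → e ∈ ⟦ avoids? t ⟧
    avoid _ t∈ h∈ = ∈⟦⟧⁺ (avoids? t) (≢t t∈ , ≢t h∈)

module Costs {c ℓ₁ ℓ₂} (K : OrderedAbelianGroup c ℓ₁ ℓ₂) (G : Digraph) where

  open OrderedAbelianGroup K
  open Digraph G
  open MinCost K G
  open CommutativeMonoid commutativeMonoid using () renaming (comm to +-comm)
  open import Algebra.Properties.CommutativeMonoid.Sum commutativeMonoid using (sum)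
  open IsTotalOrder isTotalOrder
    using (≤-respˡ-≈; ≤-respʳ-≈) renaming (refl to ≤-refl; trans to ≤-trans)

  +-mono-≤ : ∀ {x y z w} → x ≤ y → z ≤ w → (x + z) ≤ (y + w)
  +-mono-≤ {x} {y} {z} {w} x≤y z≤w = ≤-trans (+-monoˡ-≤ z x≤y)
    (≤-respˡ-≈ (+-comm z y) (≤-respʳ-≈ (+-comm w y) (+-monoˡ-≤ y z≤w)))

  sum-mono-≤ : ∀ {n} {g h : Fin n → Carrier} → (∀ i → g i ≤ h i) → sum g ≤ sum h
  sum-mono-≤ {zero}  g≤h = ≤-refl
  sum-mono-≤ {suc n} g≤h = +-mono-≤ (g≤h zero) (sum-mono-≤ (g≤h ∘ suc))

  -- The sums are compared arc by arc; nonnegativity handles the arcs of `F′` outside `F`, whose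
  -- term is `0#` on the left.
  cost-mono : ∀ {w : Arc → Carrier} → (∀ e → 0# ≤ w e) →
              ∀ {F F′} → F ⊆ F′ → cost w F ≤ cost w F′
  cost-mono {w} 0≤w {F} {F′} F⊆F′ = sum-mono-≤ term
    where
    term : ∀ e → (if Vec.lookup F e then w e else 0#) ≤
                 (if Vec.lookup F′ e then w e else 0#)
    term e with Vec.lookup F e in e∈F | Vec.lookup F′ e in e∈F′
    ... | true  | true  = ≤-refl
    ... | false | true  = 0≤w e
    ... | false | false = ≤-refl
    ... | true  | false =
      contradiction (trans (sym e∈F′) ([]=⇒lookup (F⊆F′ (lookup⇒[]= e F e∈F)))) λ ()

  module _ {a p} {A : Set a} {P : Pred A p} {g : A → Carrier ⁺} (L : Listing P) where

    open Listing L

    -- Stated with a bound `v` above `g x` so that uses can be nested when `g x` is itself a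
    -- minimum.
    minimum≤ : ∀ {x v} → P x → g x ≤⁺ v → minimum g L ≤⁺ v
    minimum≤ Px gx≤v = Extrema.min≤v⁺ totalOrder⁺ ⊤⁺ _
      (inj₂ (lose (∈-map⁺ g (complete Px)) gx≤v))

    -- An empty family needs no separate case: the default value `⊤⁺` lies above every `v`.
    ≤minimum : ∀ {v} → (∀ {x} → P x → v ≤⁺ g x) → v ≤⁺ minimum g L
    ≤minimum v≤g = Extrema.v≤min⁺ totalOrder⁺ (SupNonStrict._≤⊤⁺ _)
      (All.map⁺ (All.tabulate (v≤g ∘ sound)))

lemma1 :
    ∀ {a ℓ₁ ℓ₂} (K : OrderedAbelianGroup a ℓ₁ ℓ₂) (G : Digraph) →
    let open OrderedAbelianGroup K
        open Digraph G
        open MinCost K G in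
    (c : Arc → Carrier) → (∀ e → 0# ≤ c e) →
    (s₁ s₂ t : Vertex) → HasPath whole s₁ s₂ →
    OPT c s₁ s₂ t ≈⁺ minimum (λ P → f c t V⟨ P ⟩) (paths (deleteVertex t) s₁ s₂)
lemma1 K G c 0≤c s₁ s₂ t _ = antisym
  -- `OPT` is at most the right-hand side: each pair of `P` and `U` yields the feasible set `δ⁺ U`,
  -- whose cost is exactly the value attained at `U`.
  (≤minimum (paths (deleteVertex t) s₁ s₂) λ {P} path →
    ≤minimum (between V⟨ P ⟩ (∁ ⁅ t ⁆)) λ (P⊆U , U⊆R) →
      minimum≤ (feasibleSets s₁ s₂ t) (δ⁺-feasible path P⊆U U⊆R) refl⁺)
  -- Conversely, the surviving path and the set reachable in G - F bound the nested minimum by the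
  -- cost of `F`.
  (≤minimum (feasibleSets s₁ s₂ t) λ {F} feasible →
    let (P , path , P⊆U , U⊆R) = feasible-path feasible
    in minimum≤ (paths (deleteVertex t) s₁ s₂) path
         (minimum≤ (between V⟨ P ⟩ (∁ ⁅ t ⁆)) (P⊆U , U⊆R)
           SupNonStrict.[ cost-mono 0≤c (δ⁺-reachable⊆ F) ]))
  where
  open OrderedAbelianGroup K
  open Digraph G
  open Walks G
  open Costs K G
  open TotalOrder totalOrder⁺ using (antisym) renaming (refl to refl⁺)
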